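{- Let $\Sigma$ be a finite non-empty alphabet, let $k\in\mathbb N$ with $k>1$, and let $w,w'\in\Sigma^*$ with $|w|\ge k$, $|w'|\ge k$ and $|w|_a<k$, $|w'|_a<k$ for all $a\in\Sigma$. Then $w\overset{J}{\sim}_{k,k-1}w'$ if and only if $p(w)=p(w')$.
   Context: $\mathbb N=\{1,2,\dots\}$, $\mathbb N_0=\mathbb N\cup\{0\}$. For a word $w\in\Sigma^*$, $|w|$ is its length, $|w|_a$ the number of occurrences of the letter $a$ in $w$, and $p(w)=(|w|_a)_{a\in\Sigma}$ its Parikh vector; $p(u)\le p(w)$ is meant componentwise. $\mathrm{ScatFact}(w)$ is the set of (not necessarily contiguous) subsequences of $w$. For $S\subseteq\Sigma^*$, $S_k=S\cap\Sigma^k$ and $S_{\le k}=\bigcup_{i=0}^k S_i$. For $\ell\in\mathbb N_0$, $\mathrm{JScatFact}(w,\ell)$ is the set of words $u\in\Sigma^*$ with $0\le\ell\le|u|-1$ (with only $\ell=0$ allowed if $u$ is empty), $p(u)\le p(w)$, and such that there is $v\in\mathrm{ScatFact}_{|u|-\ell}(u)$ with $v\in\mathrm{ScatFact}(w)$. For $v,w\in\Sigma^*$, $v\overset{J}{\sim}_{k,\ell}w$ means $\mathrm{JScatFact}_{\le k}(v,\ell)=\mathrm{JScatFact}_{\le k}(w,\ell)$. -}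

module Defs where

open import Data.Fin.Base using (Fin)
open import Data.Fin.Properties using (inj⇒≟)
open import Data.List.Base using (List; length; filter)
open import Data.List.Relation.Binary.Sublist.Propositional using (_⊆_)
open import Data.Nat.Base using (ℕ; pred; _∸_; _≤_; NonZero)
open import Data.Product.Base using (_×_; ∃-syntax)
open import Function.Bundles using (_↔_)
open import Function.Properties.Inverse using (↔⇒↣)
open import Level using (Level) renaming (suc to lsuc)
open import Relation.Binary.Definitions using (DecidableEquality)
open import Relation.Binary.PropositionalEquality.Core using (_≡_)
open import Relation.Unary using (Pred; _∈_; _≐_)

record Alphabet (c : Level) : Set (lsuc c) where
  field
    Letter      : Set c
    size        : ℕ
    .{{size≢0}} : NonZero size
    enumeration : Letter ↔ Fin size

  _≟_ : DecidableEquality Letter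
  _≟_ = inj⇒≟ (↔⇒↣ enumeration)

  Word : Set c
  Word = List Letter

  infix 8 ∣_∣ ∣_∣[_]

  ∣_∣ : Word → ℕ
  ∣_∣ = length

  ∣_∣[_] : Word → Letter → ℕ
  ∣ w ∣[ a ] = length (filter (a ≟_) w)

  -- Vectors indexed by the alphabet are functions, to be compared pointwise.
  parikh : Word → Letter → ℕ
  parikh w a = ∣ w ∣[ a ]

  infix 4 _≤ᵖ_

  _≤ᵖ_ : (Letter → ℕ) → (Letter → ℕ) → Set c
  p ≤ᵖ q = ∀ a → p a ≤ q a

  infix 9 _⟨_⟩ _⟨≤_⟩

  -- S ⟨ k ⟩ and S ⟨≤ k ⟩ render S_k and S_{≤k}.
  _⟨_⟩ : ∀ {ℓ} → Pred Word ℓ → ℕ → Pred Word ℓ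
  (S ⟨ k ⟩) w = w ∈ S × ∣ w ∣ ≡ k

  _⟨≤_⟩ : ∀ {ℓ} → Pred Word ℓ → ℕ → Pred Word ℓ
  (S ⟨≤ k ⟩) w = ∃[ i ] i ≤ k × w ∈ S ⟨ i ⟩

  ScatFact : Word → Pred Word c
  ScatFact w v = v ⊆ w

  -- For non-empty u, pred ∣ u ∣ is ∣ u ∣ - 1.  For empty u it is 0, so that
  -- exactly ℓ = 0 is allowed.  In both cases ℓ ≤ ∣ u ∣, so the subtraction
  -- ∣ u ∣ ∸ ℓ never truncates.
  JScatFact : Word → ℕ → Pred Word c
  JScatFact w ℓ u =
      ℓ ≤ pred ∣ u ∣
    × parikh u ≤ᵖ parikh w
    × ∃[ v ] v ∈ ScatFact u ⟨ ∣ u ∣ ∸ ℓ ⟩ × v ∈ ScatFact w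

  infix 4 _∼ᴶ[_,_]_

  _∼ᴶ[_,_]_ : Word → ℕ → ℕ → Word → Set c
  v ∼ᴶ[ k , ℓ ] w = JScatFact v ℓ ⟨≤ k ⟩ ≐ JScatFact w ℓ ⟨≤ k ⟩

{-# OPTIONS --safe #-}

-- For k > 1, JScatFact w (k ∸ 1) ⟨≤ k ⟩ consists exactly of the words u with
-- ∣ u ∣ ≡ k and parikh u ≤ᵖ parikh w: the common subsequence only has to be one
-- letter long, and the first letter of u will do.  So it depends on parikh w
-- alone.  Conversely, since ∣ w ∣[ a ] < k ≤ ∣ w ∣, it contains a subsequence of
-- w that keeps all the letters a of w, so it determines ∣ w ∣[ a ].
module Submission where

open import Defs
open import Data.List.Base using (List; []; _∷_; length; filter)
open import Data.List.Membership.Propositional using (_∈_)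
open import Data.List.Membership.Propositional.Properties using (∈-filter⁻)
open import Data.List.Properties using (filter-idem; filter-some)
open import Data.List.Relation.Binary.Sublist.Propositional
  using (_⊆_; []; _∷_; _∷ʳ_; ⊆-refl; from∈)
open import Data.List.Relation.Binary.Sublist.Propositional.Properties
  using (filter⁺; filter-⊆; length-mono-≤)
open import Data.List.Relation.Unary.Any using (here)
open import Data.Nat.Base using (ℕ; suc; _∸_; _≤_; _<_; z≤n; s≤s; s≤s⁻¹)
open import Data.Nat.Properties
  using (≤-refl; ≤-reflexive; ≤-trans; ≤-antisym; <⇒≤; m≤n⇒m<n∨m≡n; m+n∸n≡m)
open import Data.Product.Base using (_×_; _,_; ∃-syntax)
open import Data.Sum.Base using (inj₁; inj₂)
open import Function.Bundles using (_⇔_; mk⇔; Equivalence)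
open import Relation.Binary.PropositionalEquality
  using (_≡_; _≗_; refl; sym; cong; subst)
import Relation.Unary as Pred

-- Induction on the embedding: a letter of `ys` outside `xs` is dropped as long as more than `k`
-- letters are left; once exactly `k` are left, all of them are kept.
⊆-interpolate : ∀ {a} {A : Set a} {xs ys : List A} {k} → xs ⊆ ys →
  length xs ≤ k → k ≤ length ys → ∃[ zs ] xs ⊆ zs × zs ⊆ ys × length zs ≡ k
⊆-interpolate [] _ z≤n = [] , [] , [] , refl
⊆-interpolate (y ∷ʳ τ) xs≤k k≤ys with m≤n⇒m<n∨m≡n k≤ys
... | inj₂ refl = _ , y ∷ʳ τ , ⊆-refl , refl
... | inj₁ k<ys =
  let zs , xs⊆zs , zs⊆ys , eq = ⊆-interpolate τ xs≤k (s≤s⁻¹ k<ys)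
  in  zs , xs⊆zs , y ∷ʳ zs⊆ys , eq
⊆-interpolate (p ∷ τ) (s≤s xs≤k) (s≤s k≤ys) =
  let zs , xs⊆zs , zs⊆ys , eq = ⊆-interpolate τ xs≤k k≤ys
  in  _ ∷ zs , p ∷ xs⊆zs , refl ∷ zs⊆ys , cong suc eq

module _ {c} (𝒜 : Alphabet c) where
  open Alphabet 𝒜

  parikh-mono : ∀ {u w} → u ⊆ w → parikh u ≤ᵖ parikh w
  parikh-mono u⊆w a = length-mono-≤ (filter⁺ (a ≟_) (a ≟_) (λ { refl a≡x → a≡x }) u⊆w)

  count-positive⇒∈ : ∀ a w → 0 < ∣ w ∣[ a ] → a ∈ w
  count-positive⇒∈ a w pos with filter (a ≟_) w in eq
  -- An empty filter contradicts `pos`, and any letter that passes the filter equals `a`.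
  ... | b ∷ _ with ∈-filter⁻ (a ≟_) {xs = w} (subst (b ∈_) (sym eq) (here refl))
  ...   | b∈w , refl = b∈w

  JScatFact-maximal : ∀ {k} → 1 < k → ∀ w u →
    (JScatFact w (k ∸ 1) ⟨≤ k ⟩) u ⇔ (∣ u ∣ ≡ k × parikh u ≤ᵖ parikh w)
  JScatFact-maximal {suc (suc n)} (s≤s (s≤s _)) w u = mk⇔ (to u) (from n u)
    where
    to : ∀ u → (JScatFact w (suc n) ⟨≤ suc (suc n) ⟩) u →
         ∣ u ∣ ≡ suc (suc n) × parikh u ≤ᵖ parikh w
    -- The empty word is excluded because `pred 0` is 0, below `suc n`. For the others, `k≤u` is the
    -- lower bound on the length, with one letter removed on both sides.
    to (_ ∷ _) (_ , i≤k , (k≤u , p≤ , _) , refl) = ≤-antisym i≤k (s≤s k≤u) , p≤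

    from : ∀ n u → ∣ u ∣ ≡ suc (suc n) × parikh u ≤ᵖ parikh w →
           (JScatFact w (suc n) ⟨≤ suc (suc n) ⟩) u
    from _ (x ∷ y ∷ u) (refl , p≤) =
      _ , ≤-refl ,
      (≤-refl , p≤ ,
       -- Here `k ∸ 1` is the length of `y ∷ u`, so the required length of the common subsequence is
       -- 1.
       x ∷ [] , (from∈ (here refl) , sym (m+n∸n≡m 1 ∣ y ∷ u ∣)) , from∈ x∈w) ,
      refl
      where
      x∈w : x ∈ w
      -- The letter `x` has a positive count in the whole word, and `p≤` carries this over to `w`.
      x∈w = count-positive⇒∈ x w
              (≤-trans (filter-some (x ≟_) {xs = x ∷ y ∷ u} (here refl)) (p≤ x))

  JScatFact-⊆⇒≤ᵖ : ∀ {k} → 1 < k → ∀ w w′ → k ≤ ∣ w ∣ → (∀ a → ∣ w ∣[ a ] < k) →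
    JScatFact w (k ∸ 1) ⟨≤ k ⟩ Pred.⊆ JScatFact w′ (k ∸ 1) ⟨≤ k ⟩ →
    parikh w ≤ᵖ parikh w′
  JScatFact-⊆⇒≤ᵖ 1<k w w′ k≤w w<k J⊆J′ a =
    let u , as⊆u , u⊆w , ∣u∣≡k = ⊆-interpolate (filter-⊆ (a ≟_) w) (<⇒≤ (w<k a)) k≤w
        u∈J = Equivalence.from (JScatFact-maximal 1<k w u) (∣u∣≡k , parikh-mono u⊆w)
        _ , u≤w′ = Equivalence.to (JScatFact-maximal 1<k w′ u) (J⊆J′ u∈J)
        -- Counting `a` in the word of all letters `a` of `w` filters twice; by idempotence the
        -- count is still `∣ w ∣[ a ]`.
        w≤u = ≤-trans (≤-reflexive (cong length (sym (filter-idem (a ≟_) w))))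
                      (parikh-mono as⊆u a)
    in  ≤-trans w≤u (u≤w′ a)

  ≤ᵖ⇒JScatFact-⊆ : ∀ {k} → 1 < k → ∀ w w′ → parikh w ≤ᵖ parikh w′ →
    JScatFact w (k ∸ 1) ⟨≤ k ⟩ Pred.⊆ JScatFact w′ (k ∸ 1) ⟨≤ k ⟩
  ≤ᵖ⇒JScatFact-⊆ 1<k w w′ w≤w′ {u} u∈J =
    let ∣u∣≡k , u≤w = Equivalence.to (JScatFact-maximal 1<k w u) u∈J
    in  Equivalence.from (JScatFact-maximal 1<k w′ u)
          (∣u∣≡k , λ a → ≤-trans (u≤w a) (w≤w′ a))

proposition29 : ∀ {c} (𝒜 : Alphabet c) → let open Alphabet 𝒜 in
    (k : ℕ) → 1 < k →
    (w w′ : Word) →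
    k ≤ ∣ w ∣ → k ≤ ∣ w′ ∣ →
    (∀ a → ∣ w ∣[ a ] < k) → (∀ a → ∣ w′ ∣[ a ] < k) →
    (w ∼ᴶ[ k , k ∸ 1 ] w′) ⇔ (parikh w ≗ parikh w′)
proposition29 𝒜 k 1<k w w′ k≤w k≤w′ w<k w′<k = mk⇔ to from
  where
  open Alphabet 𝒜

  to : w ∼ᴶ[ k , k ∸ 1 ] w′ → parikh w ≗ parikh w′
  to (J⊆J′ , J′⊆J) a = ≤-antisym
    (JScatFact-⊆⇒≤ᵖ 𝒜 1<k w w′ k≤w w<k J⊆J′ a)
    (JScatFact-⊆⇒≤ᵖ 𝒜 1<k w′ w k≤w′ w′<k J′⊆J a)

  from : parikh w ≗ parikh w′ → w ∼ᴶ[ k , k ∸ 1 ] w′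
  from w≗w′ =
    ≤ᵖ⇒JScatFact-⊆ 𝒜 1<k w w′ (λ a → ≤-reflexive (w≗w′ a)) ,
    ≤ᵖ⇒JScatFact-⊆ 𝒜 1<k w′ w (λ a → ≤-reflexive (sym (w≗w′ a)))
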